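{- Let $G$ be a finite simple graph with $n=|V(G)|$, and let $v_1,\dots,v_r$, $r\ge 2$, be a $\beta$-sequence in $G$ such that $N(v_1,\dots,v_{r-1})$ is a $\delta$-set in $G$. Then $r\ge W(G)$.
   Context: Graphs are finite, undirected, without loops or multiple edges; $N(v)$ is the set of vertices adjacent to $v$, $d(v)=|N(v)|$, and $N(v_1,\dots,v_k)=\bigcap_{j=1}^k N(v_j)$. Define $W(G)=\sum_{v\in V(G)}\frac{1}{n-d(v)}$. A set $V\subseteq V(G)$ is a $\delta$-set in $G$ if $d(v)\le n-|V|$ for all $v\in V$. A sequence $v_1,\dots,v_r$ of vertices is a $\beta$-sequence in $G$ if (i) $d(v_1)=\max\{d(v)\mid v\in V(G)\}$, and (ii) for $2\le i\le r$, $v_i\in N(v_1,\dots,v_{i-1})$ and $d(v_i)=\max\{d(v)\mid v\in N(v_1,\dots,v_{i-1})\}$ (degrees taken in $G$). -}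

module Defs where

open import Algebra.Properties.CommutativeMonoid.Sum using (sum)
open import Data.Fin.Base using (Fin; toℕ; fromℕ<)
open import Data.Fin.Subset using (Subset; _∈_; _∉_; ∣_∣; ⊤; ⋂)
open import Data.Fin.Subset.Properties using (∣p∣≤n; ∣p∣≡n⇒p≡⊤; ∈⊤)
open import Data.Integer.Base using (1ℤ)
open import Data.List.Base as List using (List)
open import Data.Nat.Base using (ℕ; NonZero; _∸_; _≤_; _<_; >-nonZero)
open import Data.Nat.Properties using (≤∧≢⇒<; m<n⇒0<n∸m)
open import Data.Product.Base using (_×_; ∃-syntax)
open import Data.Rational.Base using (ℚ; _/_)
open import Data.Rational.Properties using (+-0-commutativeMonoid)
open import Data.Vec.Base using (tabulate)
open import Data.Vec.Functional using (Vector)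
open import Data.Vec.Properties using (lookup∘tabulate; []=⇒lookup)
open import Level using (0ℓ)
open import Relation.Binary.Core using (Rel)
open import Relation.Binary.Definitions using (Decidable; Symmetric; Irreflexive)
open import Relation.Binary.PropositionalEquality using (_≡_; refl; sym; trans; subst)
open import Relation.Nullary using (Dec; yes; no; does)

record SimpleGraph (n : ℕ) : Set₁ where
  infix 4 _~_ _~?_
  field
    _~_      : Rel (Fin n) 0ℓ
    _~?_     : Decidable _~_
    ~-sym    : Symmetric _~_
    ~-irrefl : Irreflexive _≡_ _~_

module _ {n : ℕ} (G : SimpleGraph n) where
  open SimpleGraph G

  N : Fin n → Subset n
  N v = tabulate λ u → does (v ~? u)

  d : Fin n → ℕ
  d v = ∣ N v ∣

  -- The empty intersection is the whole vertex set.
  commonN : List (Fin n) → Subset n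
  commonN vs = ⋂ (List.map N vs)

  v∉Nv : ∀ v → v ∉ N v
  v∉Nv v v∈Nv = absurd (v ~? v)
      (trans (sym (lookup∘tabulate _ v)) ([]=⇒lookup v∈Nv))
    where
    open import Data.Bool.Base using (true)
    open import Data.Empty using (⊥)
    absurd : (v~?v : Dec (v ~ v)) → does v~?v ≡ true → ⊥
    absurd (yes v~v) _ = ~-irrefl refl v~v
    absurd (no _)    ()

  d<n : ∀ v → d v < n
  d<n v = ≤∧≢⇒< (∣p∣≤n (N v))
    λ d≡n → v∉Nv v (subst (v ∈_) (sym (∣p∣≡n⇒p≡⊤ d≡n)) ∈⊤)

  n∸d-nonZero : ∀ v → NonZero (n ∸ d v)
  n∸d-nonZero v = >-nonZero (m<n⇒0<n∸m (d<n v))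

  W : ℚ
  W = sum +-0-commutativeMonoid λ v → _/_ 1ℤ (n ∸ d v) {{n∸d-nonZero v}}

  -- The truncated subtraction is exact, since ∣ S ∣ ≤ n.
  IsδSet : Subset n → Set
  IsδSet S = ∀ {v} → v ∈ S → d v ≤ n ∸ ∣ S ∣

  -- m = max { d u ∣ u ∈ S }
  IsMaxDegree : ℕ → Subset n → Set
  IsMaxDegree m S =
    (∃[ u ] (u ∈ S × d u ≡ m)) × (∀ {u} → u ∈ S → d u ≤ m)

  -- Common neighbourhood of the first k entries of v.
  commonNFirst : ∀ {r} → ℕ → Vector (Fin n) r → Subset n
  commonNFirst k v = commonN (List.take k (List.tabulate v))

  -- Positions are counted from 0, so exactly toℕ i entries precede v i.
  record IsβSequence {r : ℕ} (v : Vector (Fin n) r) : Set where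
    field
      nonempty : 0 < r
      first    : IsMaxDegree (d (v (fromℕ< nonempty))) ⊤
      step     : ∀ i → 1 ≤ toℕ i →
                 v i ∈ commonNFirst (toℕ i) v ×
                 IsMaxDegree (d (v i)) (commonNFirst (toℕ i) v)

{-# OPTIONS --safe #-}
-- Put S₀ = V(G) and Sₖ = N(v₁,…,vₖ).  The set Sᵣ₋₁ and the sets Sₖ₋₁ ∖ N(vₖ), k < r,
-- partition V(G), and on each part A we have n − d(u) ≥ ∣A∣: on Sᵣ₋₁ by the δ-set
-- hypothesis, on Sₖ₋₁ ∖ N(vₖ) because d(u) ≤ d(vₖ) and A avoids N(vₖ).  Hence each
-- of the r parts contributes at most 1 to W(G).
module Submission where

open import Defs
open import Data.Bool.Base using (true; false; if_then_else_; not; _∧_)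
open import Data.Nat.Base using (ℕ; zero; suc; _∸_; _≤_; NonZero; z≤n; s≤s; >-nonZero⁻¹)
import Data.Nat.Properties as ℕ
open import Data.Fin.Base using (Fin; zero; suc; toℕ; fromℕ<)
open import Data.Fin.Properties using (toℕ-fromℕ<)
open import Data.Fin.Subset
  using (Subset; inside; outside; _∈_; _∩_; ∁; ∣_∣; ⊤)
open import Data.Fin.Subset.Properties
  using (∣p∣≤n; ∣∁p∣≡n∸∣p∣; ∣p∩q∣≤∣q∣; p∩q⊆p; ∩-assoc; ∩-identityˡ; ∩-identityʳ)
open import Data.Integer.Base as ℤ using (+_; 1ℤ; +≤+)
import Data.Integer.Properties as ℤ
open import Data.List.Base as List using ([]; _∷_; _∷ʳ_)
open import Data.List.Properties using (take-suc-tabulate)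
open import Data.Product.Base using (proj₂)
open import Data.Rational.Base as ℚ using (ℚ; _/_; _≥_; _+_; 0ℚ; 1ℚ; toℚᵘ)
import Data.Rational.Properties as ℚ
open import Algebra.Properties.CommutativeMonoid.Sum ℚ.+-0-commutativeMonoid
  using (sum; ∑-distrib-+; sum-cong-≗)
open import Data.Rational.Unnormalised.Base as ℚᵘ using (mkℚᵘ; *≡*; *≤*)
import Data.Rational.Unnormalised.Properties as ℚᵘ
open import Data.Vec.Base using (lookup; []; _∷_; here; there)
open import Data.Vec.Functional using (Vector)
open import Data.Vec.Properties using (lookup-zipWith; lookup-map; lookup-replicate)
open import Function.Base using (_∘_)
open import Relation.Binary.PropositionalEquality
  using (_≡_; refl; sym; trans; cong; subst)

-- `/` cancels common factors, so neither side computes for a variable `d`. The identity is checked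
-- on unnormalised fractions and carried back. The case `d = 1` later increments the count of parts.
1/d+m/d≡[1+m]/d : ∀ m d .{{_ : NonZero d}} → 1ℤ / d + + m / d ≡ + suc m / d
1/d+m/d≡[1+m]/d m d@(suc d-1) = ℚ.toℚᵘ-injective (begin
  toℚᵘ (1ℤ / d + + m / d)                 ≈⟨ ℚ.toℚᵘ-homo-+ (1ℤ / d) (+ m / d) ⟩
  toℚᵘ (1ℤ / d) ℚᵘ.+ toℚᵘ (+ m / d)       ≈⟨ ℚᵘ.+-cong (ℚ.toℚᵘ-fromℚᵘ 1/d) (ℚ.toℚᵘ-fromℚᵘ m/d) ⟩
  1/d ℚᵘ.+ m/d                            ≈⟨ *≡* numerators ⟩
  mkℚᵘ (+ suc m) d-1                      ≈⟨ ℚ.toℚᵘ-fromℚᵘ (mkℚᵘ (+ suc m) d-1) ⟨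
  toℚᵘ (+ suc m / d)                      ∎)
  where
  open import Relation.Binary.Reasoning.Setoid ℚᵘ.≃-setoid
  1/d = mkℚᵘ 1ℤ d-1
  m/d = mkℚᵘ (+ m) d-1
  -- Unnormalised addition does not cancel, so the sum has denominator `d * d`; this is the
  -- cross-multiplied equation.
  numerators : (1ℤ ℤ.* + d ℤ.+ + m ℤ.* + d) ℤ.* + d ≡ + suc m ℤ.* (+ d ℤ.* + d)
  numerators = trans (cong (ℤ._* + d) (sym (ℤ.*-distribʳ-+ (+ d) 1ℤ (+ m))))
                     (ℤ.*-assoc (+ suc m) (+ d) (+ d))

n/n≡1 : ∀ n .{{_ : NonZero n}} → + n / n ≡ 1ℚ
n/n≡1 n@(suc n-1) = ℚ.fromℚᵘ-cong {mkℚᵘ (+ n) n-1} {mkℚᵘ 1ℤ 0} (*≡* (ℤ.*-comm (+ n) 1ℤ))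

1/-anti-≤ : ∀ {m n} .{{_ : NonZero m}} .{{_ : NonZero n}} → m ≤ n → 1ℤ / n ℚ.≤ 1ℤ / m
1/-anti-≤ {m@(suc m-1)} {n@(suc n-1)} m≤n = ℚ.toℚᵘ-cancel-≤ (begin
  toℚᵘ (1ℤ / n)    ≃⟨ ℚ.toℚᵘ-fromℚᵘ (mkℚᵘ 1ℤ n-1) ⟩
  mkℚᵘ 1ℤ n-1      ≤⟨ *≤* (ℤ.*-monoˡ-≤-nonNeg 1ℤ (+≤+ m≤n)) ⟩
  mkℚᵘ 1ℤ m-1      ≃⟨ ℚ.toℚᵘ-fromℚᵘ (mkℚᵘ 1ℤ m-1) ⟨
  toℚᵘ (1ℤ / m)    ∎)
  where open ℚᵘ.≤-Reasoning

-- Extension by zero lets sums over all subsets share the index set `Fin n`, so that splitting a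
-- subset becomes a pointwise identity.
_↾_ : ∀ {n} → Vector ℚ n → Subset n → Vector ℚ n
(g ↾ S) i = if lookup S i then g i else 0ℚ

∑∈ : ∀ {n} → Subset n → Vector ℚ n → ℚ
∑∈ S g = sum (g ↾ S)

∑∈-⊤ : ∀ {n} (g : Vector ℚ n) → sum g ≡ ∑∈ ⊤ g
∑∈-⊤ g = sum-cong-≗ λ i → cong (if_then g i else 0ℚ) (sym (lookup-replicate i inside))

∑∈-split : ∀ {n} (S T : Subset n) (g : Vector ℚ n) →
           ∑∈ S g ≡ ∑∈ (S ∩ ∁ T) g + ∑∈ (S ∩ T) g
∑∈-split S T g = trans (sum-cong-≗ pointwise) (∑-distrib-+ (g ↾ (S ∩ ∁ T)) (g ↾ (S ∩ T)))
  where
  cases : ∀ s t x → (if s then x else 0ℚ) ≡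
          (if s ∧ not t then x else 0ℚ) + (if s ∧ t then x else 0ℚ)
  cases false t     x = refl
  cases true  false x = sym (ℚ.+-identityʳ x)
  cases true  true  x = sym (ℚ.+-identityˡ x)

  pointwise : ∀ i → (g ↾ S) i ≡ (g ↾ (S ∩ ∁ T)) i + (g ↾ (S ∩ T)) i
  pointwise i rewrite lookup-zipWith _∧_ i S (∁ T) | lookup-map i not T
                    | lookup-zipWith _∧_ i S T
    = cases (lookup S i) (lookup T i) (g i)

-- The denominator `m` is independent of `∣ S ∣` so that it stays fixed while the induction shrinks
-- `S`; in the main use it is `∣ S ∣` itself.
∑∈-≤∣S∣/m : ∀ {n} m .{{_ : NonZero m}} (S : Subset n) (g : Vector ℚ n) →
            (∀ {i} → i ∈ S → g i ℚ.≤ 1ℤ / m) → ∑∈ S g ℚ.≤ + ∣ S ∣ / m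
∑∈-≤∣S∣/m m []            g g≤ = ℚ.≤-reflexive (sym (ℚ.0/n≡0 m))
∑∈-≤∣S∣/m m (outside ∷ S) g g≤ = ℚ.≤-trans
  (ℚ.≤-reflexive (ℚ.+-identityˡ _))
  (∑∈-≤∣S∣/m m S (g ∘ suc) (g≤ ∘ there))
∑∈-≤∣S∣/m m (inside  ∷ S) g g≤ = ℚ.≤-trans
  (ℚ.+-mono-≤ (g≤ here) (∑∈-≤∣S∣/m m S (g ∘ suc) (g≤ ∘ there)))
  (ℚ.≤-reflexive (1/d+m/d≡[1+m]/d ∣ S ∣ m))

-- There are `∣ S ∣` terms, each at most `1 / ∣ S ∣`.
∑∈-reciprocals≤1 : ∀ {n} (f : Fin n → ℕ) (f≢0 : ∀ i → NonZero (f i)) (S : Subset n) →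
                   (∀ {i} → i ∈ S → ∣ S ∣ ≤ f i) →
                   ∑∈ S (λ i → _/_ 1ℤ (f i) {{f≢0 i}}) ℚ.≤ 1ℚ
∑∈-reciprocals≤1 f f≢0 S ∣S∣≤f with ∣ S ∣ in ∣S∣≡
-- For empty `S` the bound `1 / ∣ S ∣` makes no sense; the denominator 1 serves instead, since every
-- `f i` is positive.
... | zero = ℚ.≤-trans
  (∑∈-≤∣S∣/m 1 S _ λ {i} _ → 1/-anti-≤ {{_}} {{f≢0 i}} (>-nonZero⁻¹ (f i) {{f≢0 i}}))
  (subst (λ k → + k / 1 ℚ.≤ 1ℚ) (sym ∣S∣≡) (ℚ.nonNegative⁻¹ 1ℚ))
... | suc m = ℚ.≤-trans
  (∑∈-≤∣S∣/m (suc m) S _ λ {i} i∈S → 1/-anti-≤ {{_}} {{f≢0 i}} (∣S∣≤f i∈S))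
  (ℚ.≤-reflexive (trans (cong (λ k → + k / suc m) ∣S∣≡) (n/n≡1 (suc m))))

module _ {n : ℕ} (G : SimpleGraph n) where

  -- The sequence grows at its end, whereas `⋂` folds from the front, so associativity has to move
  -- the new neighbourhood outward.
  commonN-∷ʳ : ∀ xs x → commonN G (xs ∷ʳ x) ≡ commonN G xs ∩ N G x
  commonN-∷ʳ []       x = trans (∩-identityʳ (N G x)) (sym (∩-identityˡ (N G x)))
  commonN-∷ʳ (y ∷ xs) x = trans (cong (N G y ∩_) (commonN-∷ʳ xs x))
                                (sym (∩-assoc (N G y) (commonN G xs) (N G x)))

  weight : Vector ℚ n
  weight u = _/_ 1ℤ (n ∸ d G u) {{n∸d-nonZero G u}}

  ∑∈-weight≤1 : ∀ S → (∀ {u} → u ∈ S → ∣ S ∣ ≤ n ∸ d G u) → ∑∈ S weight ℚ.≤ 1ℚ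
  ∑∈-weight≤1 = ∑∈-reciprocals≤1 (λ u → n ∸ d G u) (n∸d-nonZero G)

  δ-set⇒∑∈≤1 : ∀ S → IsδSet G S → ∑∈ S weight ℚ.≤ 1ℚ
  δ-set⇒∑∈≤1 S δ = ∑∈-weight≤1 S λ {u} u∈S → begin
    -- Subtracting twice from `n` is exact because `∣ S ∣ ≤ n`; it turns the upper bound on degrees
    -- into a lower bound on `n ∸ d G u`.
    ∣ S ∣              ≡⟨ ℕ.m∸[m∸n]≡n (∣p∣≤n S) ⟨
    n ∸ (n ∸ ∣ S ∣)    ≤⟨ ℕ.∸-monoʳ-≤ n (δ u∈S) ⟩
    n ∸ d G u          ∎
    where open ℕ.≤-Reasoning

  non-neighbours-∑∈≤1 : ∀ S x → (∀ {u} → u ∈ S → d G u ≤ d G x) →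
                        ∑∈ (S ∩ ∁ (N G x)) weight ℚ.≤ 1ℚ
  non-neighbours-∑∈≤1 S x d≤dx = ∑∈-weight≤1 (S ∩ ∁ (N G x)) λ {u} u∈ → begin
    ∣ S ∩ ∁ (N G x) ∣  ≤⟨ ∣p∩q∣≤∣q∣ S (∁ (N G x)) ⟩
    ∣ ∁ (N G x) ∣      ≡⟨ ∣∁p∣≡n∸∣p∣ (N G x) ⟩
    n ∸ d G x          ≤⟨ ℕ.∸-monoʳ-≤ n (d≤dx (p∩q⊆p S (∁ (N G x)) u∈)) ⟩
    n ∸ d G u          ∎
    where open ℕ.≤-Reasoning

  module _ {r : ℕ} {v : Vector (Fin n) r} (β : IsβSequence G v) where
    open IsβSequence β

    d≤d[vᵢ] : ∀ i {u} → u ∈ commonNFirst G (toℕ i) v → d G u ≤ d G (v i)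
    -- No entry precedes position 0, so the common neighbourhood reduces to `⊤`, the set in which
    -- `first` is maximal.
    d≤d[vᵢ] zero    = proj₂ first
    d≤d[vᵢ] (suc i) = proj₂ (proj₂ (step (suc i) (s≤s z≤n)))

    ∑∈-step : ∀ i → ∑∈ (commonNFirst G (toℕ i) v) weight ℚ.≤
                    1ℚ + ∑∈ (commonNFirst G (suc (toℕ i)) v) weight
    ∑∈-step i = begin
      ∑∈ S weight
        ≡⟨ ∑∈-split S (N G (v i)) weight ⟩
      ∑∈ (S ∩ ∁ (N G (v i))) weight + ∑∈ (S ∩ N G (v i)) weight
        ≤⟨ ℚ.+-monoˡ-≤ _ (non-neighbours-∑∈≤1 S (v i) (d≤d[vᵢ] i)) ⟩
      1ℚ + ∑∈ (S ∩ N G (v i)) weight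
        ≡⟨ cong (λ T → 1ℚ + ∑∈ T weight) S∩N≡ ⟩
      1ℚ + ∑∈ (commonNFirst G (suc (toℕ i)) v) weight
        ∎
      where
      open ℚ.≤-Reasoning
      S = commonNFirst G (toℕ i) v
      S∩N≡ : S ∩ N G (v i) ≡ commonNFirst G (suc (toℕ i)) v
      S∩N≡ = sym (trans (cong (commonN G) (take-suc-tabulate v i))
                        (commonN-∷ʳ (List.take (toℕ i) (List.tabulate v)) (v i)))

    -- Invariant of the peeling: the `k` parts removed so far cost at most 1 each, and the weight of
    -- the remaining common neighbourhood is still unestimated.
    W≤k+∑∈ : ∀ k → k ≤ r → W G ℚ.≤ + k / 1 + ∑∈ (commonNFirst G k v) weight
    W≤k+∑∈ zero    _   = ℚ.≤-reflexive
      (trans (∑∈-⊤ weight) (sym (ℚ.+-identityˡ (∑∈ ⊤ weight))))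
    W≤k+∑∈ (suc k) k<r = begin
      W G                                    ≤⟨ W≤k+∑∈ k (ℕ.<⇒≤ k<r) ⟩
      + k / 1 + rest k                       ≤⟨ ℚ.+-monoʳ-≤ (+ k / 1) rest-step ⟩
      + k / 1 + (1ℚ + rest (suc k))          ≡⟨ ℚ.+-assoc (+ k / 1) 1ℚ (rest (suc k)) ⟨
      (+ k / 1 + 1ℚ) + rest (suc k)          ≡⟨ cong (_+ rest (suc k)) (ℚ.+-comm (+ k / 1) 1ℚ) ⟩
      (1ℚ + + k / 1) + rest (suc k)          ≡⟨ cong (_+ rest (suc k)) (1/d+m/d≡[1+m]/d k 1) ⟩
      + suc k / 1 + rest (suc k)             ∎
      where
      open ℚ.≤-Reasoning
      rest : ℕ → ℚ
      rest j = ∑∈ (commonNFirst G j v) weight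
      rest-step : rest k ℚ.≤ 1ℚ + rest (suc k)
      -- `∑∈-step` is indexed by positions in `Fin r`, so the number `k` is turned into a position
      -- and back.
      rest-step = subst (λ j → rest j ℚ.≤ 1ℚ + rest (suc j)) (toℕ-fromℕ< k<r) (∑∈-step (fromℕ< k<r))

theorem3 : ∀ {n : ℕ} (G : SimpleGraph n) {r : ℕ} (v : Vector (Fin n) r) →
    2 ≤ r →
    IsβSequence G v →
    IsδSet G (commonNFirst G (r ∸ 1) v) →
    (+ r / 1) ≥ W G
theorem3 G {suc k} v _ β δ = begin
  -- Peeling stops at `k = r ∸ 1`, one vertex early: the remaining set is the δ-set, which supplies
  -- the last unit.
  W G                                            ≤⟨ W≤k+∑∈ G β k (ℕ.n≤1+n k) ⟩
  + k / 1 + ∑∈ (commonNFirst G k v) (weight G)   ≤⟨ ℚ.+-monoʳ-≤ (+ k / 1) (δ-set⇒∑∈≤1 G (commonNFirst G k v) δ) ⟩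
  + k / 1 + 1ℚ                                   ≡⟨ ℚ.+-comm (+ k / 1) 1ℚ ⟩
  1ℚ + + k / 1                                   ≡⟨ 1/d+m/d≡[1+m]/d k 1 ⟩
  + suc k / 1                                    ∎
  where open ℚ.≤-Reasoning
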